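{- For every integer $h\ge 2$ and every real $K>0$ there exist integers $m,n$ with $h\le m\le n$, an instance $(Q,C,D)$ of the bilinear assignment problem of sizes $m,n$, and a feasible solution $(\mathbf{x},\mathbf{y})$ that is locally optimal for the $h$-exchange neighborhood, such that $$f(\mathbf{x},\mathbf{y})-\min_{(\mathbf{x}',\mathbf{y}')\in\mathcal{F}}f(\mathbf{x}',\mathbf{y}')> K\cdot\max\{1,|f(\mathbf{x},\mathbf{y})|\}\qquad\text{and}\qquad f(\mathbf{x},\mathbf{y})>\mathcal{A}(Q,C,D).$$ That is, for any $h$, the objective value of a local optimum for the $h$-exchange neighborhood can be arbitrarily bad and can be worse than the average objective value.
   Context: Bilinear assignment problem (BAP): let $m\le n$ be positive integers, $M=\{1,\dots,m\}$, $N=\{1,\dots,n\}$. An instance $(Q,C,D)$ consists of a real $m\times m\times n\times n$ array $Q=(q_{ijkl})$, a real $m\times m$ matrix $C=(c_{ij})$ and a real $n\times n$ matrix $D=(d_{kl})$. Let $\mathcal{X}$ (resp. $\mathcal{Y}$) be the set of $m\times m$ (resp. $n\times n$) permutation matrices. The feasible set is $\mathcal{F}=\mathcal{X}\times\mathcal{Y}$, and the objective, to be minimized, is $$f(\mathbf{x},\mathbf{y})=\sum_{i,j\in M}\sum_{k,l\in N} q_{ijkl}x_{ij}y_{kl}+\sum_{i,j\in M}c_{ij}x_{ij}+\sum_{k,l\in N}d_{kl}y_{kl}.$$ $\mathcal{A}(Q,C,D)$ is the arithmetic mean of $f$ over $\mathcal{F}$. The $h$-exchange neighborhood of $(\mathbf{x},\mathbf{y})\in\mathcal{F}$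 consists of all $(\mathbf{x}',\mathbf{y})$ with $\mathbf{x}'\in\mathcal{X}$ obtained from $\mathbf{x}$ by reassigning at most $h$ of the row indices (i.e. $\mathbf{x}'$ and $\mathbf{x}$ differ in at most $h$ rows), together with all $(\mathbf{x},\mathbf{y}')$ with $\mathbf{y}'\in\mathcal{Y}$ differing from $\mathbf{y}$ in at most $h$ rows; so only one of $\mathbf{x},\mathbf{y}$ is changed at a time. A feasible solution is locally optimal for a neighborhood if no solution in its neighborhood has strictly smaller objective value. -}

module Defs where

import Algebra.Bundles as Bundles
import Algebra.Properties.AbelianGroup as AbelianGroup
import Algebra.Properties.CommutativeSemigroup as CommutativeSemigroup
open import Data.Bool.Base using (Bool; true; false; if_then_else_)
import Data.Bool.Properties as Bool
open import Data.Fin.Base using (Fin)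
import Data.Fin.Properties as Fin
open import Data.List.Base as List using (List; []; _∷_)
open import Data.List.Membership.Propositional using (_∈_)
open import Data.List.Membership.Propositional.Properties
  using (∈-cartesianProductWith⁺; ∈-cartesianProduct⁺; ∈-cartesianProduct⁻;
         ∈-filter⁺; ∈-filter⁻)
open import Data.List.Relation.Unary.All using ([]; _∷_)
open import Data.List.Relation.Unary.AllPairs.Core using ([]; _∷_)
open import Data.List.Relation.Unary.Any using (here; there)
open import Data.List.Relation.Unary.Unique.Propositional using (Unique)
import Data.List.Relation.Unary.Unique.Propositional.Properties as Unique
open import Data.Nat.Base as ℕ using (ℕ; zero; suc)
import Data.Nat.Properties as ℕ
open import Data.Integer.Base using (+_)
open import Data.Product.Base using (∃-syntax; _×_; _,_; proj₁; proj₂)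
open import Data.Rational.Base as ℚ using (ℚ; 0ℚ; 1ℚ; ½)
import Data.Rational.Properties as ℚ
open import Data.Sum.Base using (_⊎_; inj₁; inj₂)
open import Data.Vec.Base as Vec using (Vec; []; _∷_; lookup)
open import Data.Vec.Properties using (≡-dec; ∷-injective)
import Data.Vec.Functional as Functional
open import Function.Base using (id)
open import Relation.Binary.PropositionalEquality
open import Relation.Nullary.Decidable using (_×-dec_; ¬?)
open import Relation.Nullary.Negation using (¬_)
open import Relation.Unary using (Decidable)

-- Real numbers are Cauchy sequences of rationals with a modulus of
-- convergence, taken up to _≃_.

Eventually : (ℕ → Set) → Set
Eventually P = ∃[ N ] ∀ n → N ℕ.≤ n → P n

IsCauchy : (ℕ → ℚ) → Set
IsCauchy s = ∀ ε → 0ℚ ℚ.< ε →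
  ∃[ N ] ∀ m n → N ℕ.≤ m → N ℕ.≤ n → ℚ.∣ s m ℚ.- s n ∣ ℚ.< ε

record ℝ : Set where
  constructor mkℝ
  field
    seq    : ℕ → ℚ
    cauchy : IsCauchy seq

open ℝ public

infix 4 _≃_ _<_ _>_ _≤_

_≃_ : ℝ → ℝ → Set
x ≃ y = ∀ ε → 0ℚ ℚ.< ε →
  Eventually λ n → ℚ.∣ seq x n ℚ.- seq y n ∣ ℚ.< ε

_<_ : ℝ → ℝ → Set
x < y = ∃[ ε ] 0ℚ ℚ.< ε × Eventually λ n → seq x n ℚ.+ ε ℚ.≤ seq y n

_>_ : ℝ → ℝ → Set
x > y = y < x

_≤_ : ℝ → ℝ → Set
x ≤ y = ¬ (y < x)

private
  p≤∣p∣ : ∀ p → p ℚ.≤ ℚ.∣ p ∣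
  p≤∣p∣ p with ℚ.≤-total 0ℚ p
  ... | inj₁ 0≤p = ℚ.≤-reflexive (sym (ℚ.0≤p⇒∣p∣≡p 0≤p))
  ... | inj₂ p≤0 = ℚ.≤-trans p≤0 (ℚ.0≤∣p∣ p)

  module +-Group = AbelianGroup ℚ.+-0-abelianGroup
  module +-Semigroup = CommutativeSemigroup
    (Bundles.AbelianGroup.commutativeSemigroup ℚ.+-0-abelianGroup)

  neg-sub : ∀ p q → ℚ.- (p ℚ.- q) ≡ q ℚ.- p
  neg-sub = +-Group.⁻¹-anti-homo‿-

  sub+cancel : ∀ p q → (p ℚ.- q) ℚ.+ q ≡ p
  sub+cancel p q = trans (ℚ.+-assoc p (ℚ.- q) q)
    (trans (cong (p ℚ.+_) (ℚ.+-inverseˡ q)) (ℚ.+-identityʳ p))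

  telescope : ∀ p q r → (p ℚ.- q) ℚ.+ (q ℚ.- r) ≡ p ℚ.- r
  telescope p q r = trans (sym (ℚ.+-assoc (p ℚ.- q) q (ℚ.- r)))
    (cong (ℚ._- r) (sub+cancel p q))

  *-distribˡ-sub : ∀ p q r → p ℚ.* (q ℚ.- r) ≡ p ℚ.* q ℚ.- p ℚ.* r
  *-distribˡ-sub p q r = trans (ℚ.*-distribˡ-+ p q (ℚ.- r))
    (cong (p ℚ.* q ℚ.+_) (sym (ℚ.neg-distribʳ-* p r)))

  ∣p-q∣-sym : ∀ p q → ℚ.∣ p ℚ.- q ∣ ≡ ℚ.∣ q ℚ.- p ∣
  ∣p-q∣-sym p q =
    trans (sym (ℚ.∣-p∣≡∣p∣ (p ℚ.- q))) (cong ℚ.∣_∣ (neg-sub p q))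

  half+half : ∀ p → ½ ℚ.* p ℚ.+ ½ ℚ.* p ≡ p
  half+half p = trans (sym (ℚ.*-distribʳ-+ p ½ ½)) (ℚ.*-identityˡ p)

  half-pos : ∀ {p} → 0ℚ ℚ.< p → 0ℚ ℚ.< ½ ℚ.* p
  half-pos {p} 0<p = ℚ.positive⁻¹ (½ ℚ.* p)
    where instance _ = ℚ.pos*pos⇒pos ½ p {{ℚ.positive 0<p}}

  +-cauchy : ∀ {s t} → IsCauchy s → IsCauchy t →
             IsCauchy (λ n → s n ℚ.+ t n)
  +-cauchy {s} {t} cs ct ε 0<ε
    with cs (½ ℚ.* ε) (half-pos 0<ε) | ct (½ ℚ.* ε) (half-pos 0<ε)
  ... | N₁ , p₁ | N₂ , p₂ = N₁ ℕ.⊔ N₂ , λ m n N≤m N≤n → begin-strict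
    ℚ.∣ (s m ℚ.+ t m) ℚ.- (s n ℚ.+ t n) ∣
      ≡⟨ cong ℚ.∣_∣ (rearrange (s m) (t m) (s n) (t n)) ⟩
    ℚ.∣ (s m ℚ.- s n) ℚ.+ (t m ℚ.- t n) ∣
      ≤⟨ ℚ.∣p+q∣≤∣p∣+∣q∣ (s m ℚ.- s n) (t m ℚ.- t n) ⟩
    ℚ.∣ s m ℚ.- s n ∣ ℚ.+ ℚ.∣ t m ℚ.- t n ∣
      <⟨ ℚ.+-mono-< (p₁ m n (ℕ.m⊔n≤o⇒m≤o N₁ N₂ N≤m) (ℕ.m⊔n≤o⇒m≤o N₁ N₂ N≤n))
                    (p₂ m n (ℕ.m⊔n≤o⇒n≤o N₁ N₂ N≤m) (ℕ.m⊔n≤o⇒n≤o N₁ N₂ N≤n)) ⟩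
    ½ ℚ.* ε ℚ.+ ½ ℚ.* ε
      ≡⟨ half+half ε ⟩
    ε ∎
    where
    open ℚ.≤-Reasoning
    rearrange : ∀ a b c d →
      (a ℚ.+ b) ℚ.- (c ℚ.+ d) ≡ (a ℚ.- c) ℚ.+ (b ℚ.- d)
    rearrange a b c d = trans (cong (a ℚ.+ b ℚ.+_) (ℚ.neg-distrib-+ c d))
      (+-Semigroup.interchange a b (ℚ.- c) (ℚ.- d))

  neg-cauchy : ∀ {s} → IsCauchy s → IsCauchy (λ n → ℚ.- s n)
  neg-cauchy {s} cs ε 0<ε with cs ε 0<ε
  ... | N , p = N , λ m n N≤m N≤n →
    subst (ℚ._< ε) (sym (eq (s m) (s n))) (p m n N≤m N≤n)
    where
    eq : ∀ a b → ℚ.∣ ℚ.- a ℚ.- ℚ.- b ∣ ≡ ℚ.∣ a ℚ.- b ∣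
    eq a b = trans
      (cong ℚ.∣_∣ (sym (ℚ.neg-distrib-+ a (ℚ.- b))))
      (ℚ.∣-p∣≡∣p∣ (a ℚ.- b))

  eventually-bounded : ∀ {s} → IsCauchy s →
    ∃[ B ] 0ℚ ℚ.< B × Eventually λ n → ℚ.∣ s n ∣ ℚ.≤ B
  eventually-bounded {s} cs with cs 1ℚ (ℚ.positive⁻¹ 1ℚ)
  ... | N , p = 1ℚ ℚ.+ ℚ.∣ s N ∣ , 0<B , N , bound
    where
    open ℚ.≤-Reasoning
    0<B : 0ℚ ℚ.< 1ℚ ℚ.+ ℚ.∣ s N ∣
    0<B = ℚ.+-mono-<-≤ (ℚ.positive⁻¹ 1ℚ) (ℚ.0≤∣p∣ (s N))
    bound : ∀ n → N ℕ.≤ n → ℚ.∣ s n ∣ ℚ.≤ 1ℚ ℚ.+ ℚ.∣ s N ∣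
    bound n N≤n = begin
      ℚ.∣ s n ∣                           ≡⟨ cong ℚ.∣_∣ (sym (sub+cancel (s n) (s N))) ⟩
      ℚ.∣ (s n ℚ.- s N) ℚ.+ s N ∣         ≤⟨ ℚ.∣p+q∣≤∣p∣+∣q∣ (s n ℚ.- s N) (s N) ⟩
      ℚ.∣ s n ℚ.- s N ∣ ℚ.+ ℚ.∣ s N ∣     ≤⟨ ℚ.+-monoˡ-≤ ℚ.∣ s N ∣ (ℚ.<⇒≤ (p n N N≤n ℕ.≤-refl)) ⟩
      1ℚ ℚ.+ ℚ.∣ s N ∣                    ∎

  shrink : ∀ C ε → 0ℚ ℚ.< C → 0ℚ ℚ.< ε → ∃[ δ ] 0ℚ ℚ.< δ × C ℚ.* δ ≡ ε
  shrink C ε 0<C 0<ε = C⁻¹ ℚ.* ε , 0<δ , Cδ≡ε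
    where
    C-pos : ℚ.Positive C
    C-pos = ℚ.positive 0<C
    C-nonZero : ℚ.NonZero C
    C-nonZero = ℚ.pos⇒nonZero C {{C-pos}}
    C⁻¹ = (ℚ.1/ C) {{C-nonZero}}
    0<δ : 0ℚ ℚ.< C⁻¹ ℚ.* ε
    0<δ = ℚ.positive⁻¹ (C⁻¹ ℚ.* ε)
      {{ℚ.pos*pos⇒pos C⁻¹ {{ℚ.1/pos⇒pos C {{C-pos}}}} ε {{ℚ.positive 0<ε}}}}
    Cδ≡ε : C ℚ.* (C⁻¹ ℚ.* ε) ≡ ε
    Cδ≡ε = trans (sym (ℚ.*-assoc C C⁻¹ ε))
      (trans (cong (ℚ._* ε) (ℚ.*-inverseʳ C {{C-nonZero}})) (ℚ.*-identityˡ ε))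

  ∣*∣-bound : ∀ {C δ} u v → 0ℚ ℚ.< C → ℚ.∣ u ∣ ℚ.≤ C → ℚ.∣ v ∣ ℚ.< δ →
              ℚ.∣ u ℚ.* v ∣ ℚ.< C ℚ.* δ
  ∣*∣-bound {C} {δ} u v 0<C u≤C v<δ = begin-strict
    ℚ.∣ u ℚ.* v ∣          ≡⟨ ℚ.∣p*q∣≡∣p∣*∣q∣ u v ⟩
    ℚ.∣ u ∣ ℚ.* ℚ.∣ v ∣    ≤⟨ ℚ.*-monoʳ-≤-nonNeg ℚ.∣ v ∣ {{ℚ.∣-∣-nonNeg v}} u≤C ⟩
    C ℚ.* ℚ.∣ v ∣          <⟨ ℚ.*-monoʳ-<-pos C {{ℚ.positive 0<C}} v<δ ⟩
    C ℚ.* δ                ∎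
    where open ℚ.≤-Reasoning

  *-close : ∀ {A B α β ε} a b c d → 0ℚ ℚ.< A → 0ℚ ℚ.< B →
            A ℚ.* α ≡ ½ ℚ.* ε → B ℚ.* β ≡ ½ ℚ.* ε →
            ℚ.∣ a ∣ ℚ.≤ A → ℚ.∣ d ∣ ℚ.≤ B →
            ℚ.∣ b ℚ.- d ∣ ℚ.< α → ℚ.∣ a ℚ.- c ∣ ℚ.< β →
            ℚ.∣ a ℚ.* b ℚ.- c ℚ.* d ∣ ℚ.< ε
  *-close {A} {B} {α} {β} {ε} a b c d 0<A 0<B Aα Bβ a≤A d≤B bd ac = begin-strict
    ℚ.∣ a ℚ.* b ℚ.- c ℚ.* d ∣
      ≡⟨ cong ℚ.∣_∣ rearrange ⟩
    ℚ.∣ a ℚ.* (b ℚ.- d) ℚ.+ d ℚ.* (a ℚ.- c) ∣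
      ≤⟨ ℚ.∣p+q∣≤∣p∣+∣q∣ (a ℚ.* (b ℚ.- d)) (d ℚ.* (a ℚ.- c)) ⟩
    ℚ.∣ a ℚ.* (b ℚ.- d) ∣ ℚ.+ ℚ.∣ d ℚ.* (a ℚ.- c) ∣
      <⟨ ℚ.+-mono-< (∣*∣-bound a (b ℚ.- d) 0<A a≤A bd)
                    (∣*∣-bound d (a ℚ.- c) 0<B d≤B ac) ⟩
    A ℚ.* α ℚ.+ B ℚ.* β
      ≡⟨ cong₂ ℚ._+_ Aα Bβ ⟩
    ½ ℚ.* ε ℚ.+ ½ ℚ.* ε
      ≡⟨ half+half ε ⟩
    ε ∎
    where
    open ℚ.≤-Reasoning
    rearrange : a ℚ.* b ℚ.- c ℚ.* d ≡ a ℚ.* (b ℚ.- d) ℚ.+ d ℚ.* (a ℚ.- c)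
    rearrange = sym (trans
      (cong₂ ℚ._+_ (*-distribˡ-sub a b d) (trans (*-distribˡ-sub d a c)
        (cong₂ ℚ._-_ (ℚ.*-comm d a) (ℚ.*-comm d c))))
      (telescope (a ℚ.* b) (a ℚ.* d) (c ℚ.* d)))

  *-cauchy : ∀ {s t} → IsCauchy s → IsCauchy t →
             IsCauchy (λ n → s n ℚ.* t n)
  *-cauchy {s} {t} cs ct ε 0<ε
    with A , 0<A , N₁ , boundA ← eventually-bounded cs
       | B , 0<B , N₂ , boundB ← eventually-bounded ct
    with α , 0<α , Aα ← shrink A (½ ℚ.* ε) 0<A (half-pos 0<ε)
       | β , 0<β , Bβ ← shrink B (½ ℚ.* ε) 0<B (half-pos 0<ε)
    with N₃ , ps ← cs β 0<β | N₄ , pt ← ct α 0<α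
    = N , λ m n N≤m N≤n →
      *-close {A} {B} {α} {β} (s m) (t m) (s n) (t n) 0<A 0<B Aα Bβ
        (boundA m (≤₁ N≤m)) (boundB n (≤₂ N≤n))
        (pt m n (≤₄ N≤m) (≤₄ N≤n)) (ps m n (≤₃ N≤m) (≤₃ N≤n))
    where
    N = (N₁ ℕ.⊔ N₂) ℕ.⊔ (N₃ ℕ.⊔ N₄)
    ≤₁ : ∀ {k} → N ℕ.≤ k → N₁ ℕ.≤ k
    ≤₁ N≤k = ℕ.m⊔n≤o⇒m≤o N₁ N₂ (ℕ.m⊔n≤o⇒m≤o (N₁ ℕ.⊔ N₂) (N₃ ℕ.⊔ N₄) N≤k)
    ≤₂ : ∀ {k} → N ℕ.≤ k → N₂ ℕ.≤ k
    ≤₂ N≤k = ℕ.m⊔n≤o⇒n≤o N₁ N₂ (ℕ.m⊔n≤o⇒m≤o (N₁ ℕ.⊔ N₂) (N₃ ℕ.⊔ N₄) N≤k)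
    ≤₃ : ∀ {k} → N ℕ.≤ k → N₃ ℕ.≤ k
    ≤₃ N≤k = ℕ.m⊔n≤o⇒m≤o N₃ N₄ (ℕ.m⊔n≤o⇒n≤o (N₁ ℕ.⊔ N₂) (N₃ ℕ.⊔ N₄) N≤k)
    ≤₄ : ∀ {k} → N ℕ.≤ k → N₄ ℕ.≤ k
    ≤₄ N≤k = ℕ.m⊔n≤o⇒n≤o N₃ N₄ (ℕ.m⊔n≤o⇒n≤o (N₁ ℕ.⊔ N₂) (N₃ ℕ.⊔ N₄) N≤k)

  ⊔-half : ∀ {ε} a b c d → ℚ.∣ a ℚ.- c ∣ ℚ.< ε → ℚ.∣ b ℚ.- d ∣ ℚ.< ε →
           (a ℚ.⊔ b) ℚ.- (c ℚ.⊔ d) ℚ.< ε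
  ⊔-half {ε} a b c d p q with ℚ.⊔-sel a b
  ... | inj₁ eq = begin-strict
    (a ℚ.⊔ b) ℚ.- (c ℚ.⊔ d)  ≡⟨ cong (ℚ._- (c ℚ.⊔ d)) eq ⟩
    a ℚ.- (c ℚ.⊔ d)          ≤⟨ ℚ.+-monoʳ-≤ a (ℚ.neg-antimono-≤ (ℚ.p≤p⊔q c d)) ⟩
    a ℚ.- c                  ≤⟨ p≤∣p∣ (a ℚ.- c) ⟩
    ℚ.∣ a ℚ.- c ∣            <⟨ p ⟩
    ε                        ∎
    where open ℚ.≤-Reasoning
  ... | inj₂ eq = begin-strict
    (a ℚ.⊔ b) ℚ.- (c ℚ.⊔ d)  ≡⟨ cong (ℚ._- (c ℚ.⊔ d)) eq ⟩
    b ℚ.- (c ℚ.⊔ d)          ≤⟨ ℚ.+-monoʳ-≤ b (ℚ.neg-antimono-≤ (ℚ.p≤q⊔p c d)) ⟩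
    b ℚ.- d                  ≤⟨ p≤∣p∣ (b ℚ.- d) ⟩
    ℚ.∣ b ℚ.- d ∣            <⟨ q ⟩
    ε                        ∎
    where open ℚ.≤-Reasoning

  ⊔-cauchy : ∀ {s t} → IsCauchy s → IsCauchy t →
             IsCauchy (λ n → s n ℚ.⊔ t n)
  ⊔-cauchy {s} {t} cs ct ε 0<ε with cs ε 0<ε | ct ε 0<ε
  ... | N₁ , p₁ | N₂ , p₂ = N₁ ℕ.⊔ N₂ , λ m n N≤m N≤n →
    close (s m) (t m) (s n) (t n)
      (p₁ m n (ℕ.m⊔n≤o⇒m≤o N₁ N₂ N≤m) (ℕ.m⊔n≤o⇒m≤o N₁ N₂ N≤n))
      (p₂ m n (ℕ.m⊔n≤o⇒n≤o N₁ N₂ N≤m) (ℕ.m⊔n≤o⇒n≤o N₁ N₂ N≤n))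
    where
    close : ∀ a b c d → ℚ.∣ a ℚ.- c ∣ ℚ.< ε → ℚ.∣ b ℚ.- d ∣ ℚ.< ε →
            ℚ.∣ (a ℚ.⊔ b) ℚ.- (c ℚ.⊔ d) ∣ ℚ.< ε
    close a b c d p q with ℚ.∣p∣≡p∨∣p∣≡-p ((a ℚ.⊔ b) ℚ.- (c ℚ.⊔ d))
    ... | inj₁ eq = subst (ℚ._< ε) (sym eq) (⊔-half a b c d p q)
    ... | inj₂ eq = subst (ℚ._< ε)
      (sym (trans eq (neg-sub (a ℚ.⊔ b) (c ℚ.⊔ d))))
      (⊔-half c d a b (subst (ℚ._< ε) (∣p-q∣-sym a c) p)
                      (subst (ℚ._< ε) (∣p-q∣-sym b d) q))

fromℚ : ℚ → ℝ
fromℚ q = mkℝ (λ _ → q) λ ε 0<ε → 0 , λ _ _ _ _ →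
  subst (ℚ._< ε) (sym (cong ℚ.∣_∣ (ℚ.+-inverseʳ q))) 0<ε

0ℝ 1ℝ : ℝ
0ℝ = fromℚ 0ℚ
1ℝ = fromℚ 1ℚ

infix  8 -_
infixl 7 _*_
infixl 6 _+_ _-_ _⊔_

_+_ : ℝ → ℝ → ℝ
x + y = mkℝ (λ n → seq x n ℚ.+ seq y n) (+-cauchy {seq x} {seq y} (cauchy x) (cauchy y))

_*_ : ℝ → ℝ → ℝ
x * y = mkℝ (λ n → seq x n ℚ.* seq y n) (*-cauchy {seq x} {seq y} (cauchy x) (cauchy y))

_⊔_ : ℝ → ℝ → ℝ
x ⊔ y = mkℝ (λ n → seq x n ℚ.⊔ seq y n) (⊔-cauchy {seq x} {seq y} (cauchy x) (cauchy y))

-_ : ℝ → ℝ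
- x = mkℝ (λ n → ℚ.- seq x n) (neg-cauchy {seq x} (cauchy x))

_-_ : ℝ → ℝ → ℝ
x - y = x + (- y)

∣_∣ : ℝ → ℝ
∣ x ∣ = x ⊔ (- x)

∑ : ∀ {n} → (Fin n → ℝ) → ℝ
∑ = Functional.foldr _+_ 0ℝ

-- The empty list gets a junk value; a list of all feasible solutions is
-- never empty, since identity matrices are feasible.
mean : List ℝ → ℝ
mean []       = 0ℝ
mean (x ∷ xs) =
  fromℚ (+ 1 ℚ./ suc (List.length xs)) * List.foldr _+_ 0ℝ (x ∷ xs)

IsMinimum : {A : Set} → (A → Set) → (A → ℝ) → ℝ → Set
IsMinimum P f μ = (∃[ a ] P a × f a ≃ μ) × (∀ a → P a → μ ≤ f a)

Matrix01 : ℕ → Set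
Matrix01 n = Vec (Vec Bool n) n

row column : ∀ {n} → Matrix01 n → Fin n → Vec Bool n
row    x i = lookup x i
column x j = Vec.map (λ r → lookup r j) x

entry : ∀ {n} → Matrix01 n → Fin n → Fin n → ℝ
entry x i j = if lookup (row x i) j then 1ℝ else 0ℝ

IsPermutationMatrix : ∀ {n} → Matrix01 n → Set
IsPermutationMatrix x =
  (∀ i → Vec.countᵇ id (row x i) ≡ 1) × (∀ j → Vec.countᵇ id (column x j) ≡ 1)

isPermutationMatrix? : ∀ {n} → Decidable (IsPermutationMatrix {n})
isPermutationMatrix? x =
  Fin.all? (λ i → Vec.countᵇ id (row x i) ℕ.≟ 1) ×-dec
  Fin.all? (λ j → Vec.countᵇ id (column x j) ℕ.≟ 1)

differingRows : ∀ {n} → Matrix01 n → Matrix01 n → ℕ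
differingRows {n} x x′ = List.length
  (List.filter (λ i → ¬? (≡-dec Bool._≟_ (row x i) (row x′ i))) (List.allFin n))

vectors : {A : Set} → List A → ∀ n → List (Vec A n)
vectors as zero    = [] ∷ []
vectors as (suc n) = List.cartesianProductWith _∷_ as (vectors as n)

matrices01 : ∀ n → List (Matrix01 n)
matrices01 n = vectors (vectors (false ∷ true ∷ []) n) n

permutationMatrices : ∀ n → List (Matrix01 n)
permutationMatrices n = List.filter isPermutationMatrix? (matrices01 n)

private
  ∈-vectors : {A : Set} {as : List A} → (∀ a → a ∈ as) →
              ∀ {n} (v : Vec A n) → v ∈ vectors as n
  ∈-vectors all []      = here refl
  ∈-vectors all (a ∷ v) = ∈-cartesianProductWith⁺ _∷_ (all a) (∈-vectors all v)

  vectors-unique : {A : Set} {as : List A} → Unique as →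
                   ∀ n → Unique (vectors as n)
  vectors-unique u zero    = [] ∷ []
  vectors-unique u (suc n) =
    Unique.cartesianProductWith⁺ _∷_ ∷-injective u (vectors-unique u n)

  ∈-bools : ∀ b → b ∈ false ∷ true ∷ []
  ∈-bools false = here refl
  ∈-bools true  = there (here refl)

  bools-unique : Unique (false ∷ true ∷ [])
  bools-unique = ((λ ()) ∷ []) ∷ [] ∷ []

permutationMatrices-complete : ∀ {n} (x : Matrix01 n) →
  IsPermutationMatrix x → x ∈ permutationMatrices n
permutationMatrices-complete x =
  ∈-filter⁺ isPermutationMatrix? (∈-vectors (∈-vectors ∈-bools) x)

permutationMatrices-sound : ∀ {n} {x : Matrix01 n} →
  x ∈ permutationMatrices n → IsPermutationMatrix x
permutationMatrices-sound {n} x∈ =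
  proj₂ (∈-filter⁻ isPermutationMatrix? {xs = matrices01 n} x∈)

permutationMatrices-unique : ∀ n → Unique (permutationMatrices n)
permutationMatrices-unique n = Unique.filter⁺ isPermutationMatrix?
  (vectors-unique (vectors-unique bools-unique n) n)

record Instance (m n : ℕ) : Set where
  field
    Q : Fin m → Fin m → Fin n → Fin n → ℝ
    C : Fin m → Fin m → ℝ
    D : Fin n → Fin n → ℝ

Solution : ℕ → ℕ → Set
Solution m n = Matrix01 m × Matrix01 n

Feasible : ∀ {m n} → Solution m n → Set
Feasible (x , y) = IsPermutationMatrix x × IsPermutationMatrix y

feasibleSolutions : ∀ m n → List (Solution m n)
feasibleSolutions m n =
  List.cartesianProduct (permutationMatrices m) (permutationMatrices n)

feasibleSolutions-complete : ∀ {m n} (z : Solution m n) →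
  Feasible z → z ∈ feasibleSolutions m n
feasibleSolutions-complete (x , y) (px , py) = ∈-cartesianProduct⁺
  (permutationMatrices-complete x px) (permutationMatrices-complete y py)

feasibleSolutions-sound : ∀ {m n} {z : Solution m n} →
  z ∈ feasibleSolutions m n → Feasible z
feasibleSolutions-sound {m} {n} z∈
  with x∈ , y∈ ← ∈-cartesianProduct⁻ (permutationMatrices m) (permutationMatrices n) z∈
  = permutationMatrices-sound x∈ , permutationMatrices-sound y∈

feasibleSolutions-unique : ∀ m n → Unique (feasibleSolutions m n)
feasibleSolutions-unique m n = Unique.cartesianProduct⁺
  (permutationMatrices-unique m) (permutationMatrices-unique n)

objective : ∀ {m n} → Instance m n → Solution m n → ℝ
objective I (x , y) =
    (∑ λ i → ∑ λ j → ∑ λ k → ∑ λ l → Q i j k l * entry x i j * entry y k l)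
  + (∑ λ i → ∑ λ j → C i j * entry x i j)
  + (∑ λ k → ∑ λ l → D k l * entry y k l)
  where open Instance I

averageObjective : ∀ {m n} → Instance m n → ℝ
averageObjective {m} {n} I = mean (List.map (objective I) (feasibleSolutions m n))

-- ExchangeNeighbor h z z′ says that z′ lies in the neighborhood of z.
ExchangeNeighbor : ∀ {m n} → ℕ → Solution m n → Solution m n → Set
ExchangeNeighbor h (x , y) (x′ , y′) =
    (IsPermutationMatrix x′ × differingRows x x′ ℕ.≤ h × y′ ≡ y)
  ⊎ (IsPermutationMatrix y′ × differingRows y y′ ℕ.≤ h × x′ ≡ x)

LocallyOptimal : ∀ {m n} → ℕ → Instance m n → Solution m n → Set
LocallyOptimal h I z =
  ∀ z′ → ExchangeNeighbor h z z′ → ¬ (objective I z′ < objective I z)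

{-# OPTIONS --safe #-}

-- Let the only nonzero coefficient be q₁₂₁₂ = -L, so that f(x, y) = -L x₁₂ y₁₂.
-- At (id, id) both factors vanish, so changing only one of x and y, in any number
-- of rows, leaves f at 0; transposing 1 and 2 in both gives the minimum -L.
-- No value is positive and one is -L, so the average is negative.
module Submission where

open import Defs
open import Data.Bool.Base using (Bool; true; false; if_then_else_; _∧_)
open import Data.Bool.Properties using (∧-zeroʳ)
open import Data.Fin.Base using (Fin; zero; suc)
import Data.Fin.Properties as Fin
open import Data.Fin.Permutation as Perm using (Permutation′; _⟨$⟩ʳ_; _⟨$⟩ˡ_)
open import Data.Integer.Base using (+_)
open import Data.List.Base as List using ([]; _∷_)
open import Data.List.Membership.Propositional using (_∈_)
open import Data.List.Relation.Unary.Any using (here; there)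
open import Data.Nat.Base as ℕ using (ℕ; zero; suc; z≤n; s≤s)
import Data.Nat.Properties as ℕ
open import Data.Product.Base using (Σ-syntax; ∃-syntax; _×_; _,_)
open import Data.Rational.Base as ℚ using (ℚ; 0ℚ; 1ℚ)
import Data.Rational.Properties as ℚ
open import Algebra.Properties.AbelianGroup ℚ.+-0-abelianGroup using (⁻¹-involutive)
open import Data.Sum.Base using (inj₁; inj₂)
open import Data.Vec.Base as Vec using (tabulate)
open import Data.Vec.Properties using (lookup∘tabulate; tabulate-∘; tabulate-cong)
open import Function.Base using (id; _∘_)
open import Function.Bundles using (mk⇔)
open import Relation.Binary.PropositionalEquality
open import Relation.Nullary.Negation using (¬_)
open import Relation.Nullary.Decidable using (Dec; does; does-⇔; dec-true; dec-false; _×-dec_)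

-- Comparing reals through their representing sequences

≤-pointwise : ∀ x y → (∀ t → seq x t ℚ.≤ seq y t) → x ≤ y
-- Since `x ≤ y` means that `y < x` is absurd, a contradiction at the single index `N` suffices.
≤-pointwise x y x≤y (ε , 0<ε , N , y+ε≤x) = ℚ.<-irrefl refl (begin-strict
  seq y N          ≡⟨ ℚ.+-identityʳ (seq y N) ⟨
  seq y N ℚ.+ 0ℚ   <⟨ ℚ.+-monoʳ-< (seq y N) 0<ε ⟩
  seq y N ℚ.+ ε    ≤⟨ y+ε≤x N ℕ.≤-refl ⟩
  seq x N          ≤⟨ x≤y N ⟩
  seq y N          ∎)
  where open ℚ.≤-Reasoning

≃-pointwise : ∀ x y → (∀ t → seq x t ≡ seq y t) → x ≃ y
≃-pointwise x y x≡y ε 0<ε = 0 , λ t _ → subst (ℚ._< ε)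
  (sym (cong ℚ.∣_∣ (trans (cong (ℚ._- seq y t) (x≡y t)) (ℚ.+-inverseʳ (seq y t)))))
  0<ε

p≤∣p∣ : ∀ p → p ℚ.≤ ℚ.∣ p ∣
p≤∣p∣ p with ℚ.≤-total 0ℚ p
... | inj₁ 0≤p = ℚ.≤-reflexive (sym (ℚ.0≤p⇒∣p∣≡p 0≤p))
... | inj₂ p≤0 = ℚ.≤-trans p≤0 (ℚ.0≤∣p∣ p)

-- Cauchyness with tolerance 1 keeps every term from some index `N` on within 1 of `seq x N`. This
-- turns the real bound `K` into a rational one, so the coefficient of the instance can be rational.
eventually-≤ : ∀ x → ∃[ B ] 0ℚ ℚ.< B × Eventually λ t → seq x t ℚ.≤ B
eventually-≤ x with cauchy x 1ℚ (ℚ.positive⁻¹ 1ℚ)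
... | N , close = 1ℚ ℚ.+ ℚ.∣ a ∣
    , ℚ.+-mono-<-≤ (ℚ.positive⁻¹ 1ℚ) (ℚ.0≤∣p∣ a) , N , λ t N≤t → begin
  seq x t                        ≡⟨ ℚ.+-identityʳ (seq x t) ⟨
  seq x t ℚ.+ 0ℚ                 ≡⟨ cong (seq x t ℚ.+_) (ℚ.+-inverseˡ a) ⟨
  seq x t ℚ.+ (ℚ.- a ℚ.+ a)      ≡⟨ ℚ.+-assoc (seq x t) (ℚ.- a) a ⟨
  (seq x t ℚ.- a) ℚ.+ a          ≤⟨ ℚ.+-mono-≤ (ℚ.≤-trans (p≤∣p∣ (seq x t ℚ.- a))
                                      (ℚ.<⇒≤ (close t N N≤t ℕ.≤-refl))) (p≤∣p∣ a) ⟩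
  1ℚ ℚ.+ ℚ.∣ a ∣                 ∎
  where
  open ℚ.≤-Reasoning
  a = seq x N

-- Finite sums and means, evaluated at one index of the sequences

∑-zero : ∀ {n} (f : Fin n → ℝ) t → (∀ i → seq (f i) t ≡ 0ℚ) → seq (∑ f) t ≡ 0ℚ
∑-zero {zero}  f t f≡0 = refl
∑-zero {suc n} f t f≡0 = cong₂ ℚ._+_ (f≡0 zero) (∑-zero (f ∘ suc) t (f≡0 ∘ suc))

∑-single : ∀ {n} (f : Fin n → ℝ) t i →
           (∀ j → j ≢ i → seq (f j) t ≡ 0ℚ) → seq (∑ f) t ≡ seq (f i) t
∑-single f t zero    f≡0 = trans
  (cong (seq (f zero) t ℚ.+_) (∑-zero (f ∘ suc) t (λ j → f≡0 (suc j) λ ())))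
  (ℚ.+-identityʳ (seq (f zero) t))
∑-single f t (suc i) f≡0 = trans
  (cong₂ ℚ._+_ (f≡0 zero λ ())
    (∑-single (f ∘ suc) t i λ j j≢i → f≡0 (suc j) (j≢i ∘ Fin.suc-injective)))
  (ℚ.+-identityˡ (seq (f (suc i)) t))

module _ {A : Set} (t : ℕ) (f : A → ℝ) (f≤0 : ∀ z → seq (f z) t ℚ.≤ 0ℚ) where

  sum-≤0 : ∀ zs → seq (List.foldr _+_ 0ℝ (List.map f zs)) t ℚ.≤ 0ℚ
  sum-≤0 []       = ℚ.≤-refl
  sum-≤0 (z ∷ zs) = ℚ.+-mono-≤ (f≤0 z) (sum-≤0 zs)

  -- When all summands are nonpositive, discarding all but one of them can only raise the sum.
  sum-≤-member : ∀ {z} zs → z ∈ zs →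
                 seq (List.foldr _+_ 0ℝ (List.map f zs)) t ℚ.≤ seq (f z) t
  sum-≤-member (z ∷ zs) (here refl) = ℚ.≤-trans
    (ℚ.+-monoʳ-≤ (seq (f z) t) (sum-≤0 zs))
    (ℚ.≤-reflexive (ℚ.+-identityʳ (seq (f z) t)))
  sum-≤-member {z} (z₀ ∷ zs) (there z∈) = ℚ.≤-trans
    (ℚ.+-mono-≤ (f≤0 z₀) (sum-≤-member zs z∈))
    (ℚ.≤-reflexive (ℚ.+-identityˡ (seq (f z) t)))

-- The sum is at most its member `- L`, so after weighting by `w`, the reciprocal of the number of
-- values, the mean stays below 0 by at least `w * L`. This amount does not depend on `t`, as strict
-- inequality of reals demands.
mean-<0 : ∀ {A : Set} (f : A → ℝ) {z L} zs y → (∀ z t → seq (f z) t ℚ.≤ 0ℚ) → z ∈ zs →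
          0ℚ ℚ.< L → (∀ t → seq (f z) t ≡ ℚ.- L) → (∀ t → seq y t ≡ 0ℚ) →
          mean (List.map f zs) < y
-- Membership `z∈` excludes the empty list, where `mean` has its default value.
mean-<0 f {z} {L} zs@(z₀ ∷ zs′) y f≤0 z∈ 0<L fz≡-L y≡0 =
  w ℚ.* L , ℚ.positive⁻¹ (w ℚ.* L) {{ℚ.pos*pos⇒pos w L}} , 0 , λ t _ → begin
    w ℚ.* s t ℚ.+ w ℚ.* L     ≡⟨ ℚ.*-distribˡ-+ w (s t) L ⟨
    w ℚ.* (s t ℚ.+ L)         ≤⟨ ℚ.*-monoˡ-≤-nonNeg w {{ℚ.pos⇒nonNeg w}} (ℚ.+-monoˡ-≤ L
                                   (sum-≤-member t f (λ z → f≤0 z t) zs z∈)) ⟩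
    w ℚ.* (seq (f z) t ℚ.+ L) ≡⟨ cong (λ v → w ℚ.* (v ℚ.+ L)) (fz≡-L t) ⟩
    w ℚ.* (ℚ.- L ℚ.+ L)       ≡⟨ cong (w ℚ.*_) (ℚ.+-inverseˡ L) ⟩
    w ℚ.* 0ℚ                  ≡⟨ ℚ.*-zeroʳ w ⟩
    0ℚ                        ≡⟨ y≡0 t ⟨
    seq y t                   ∎
  where
  open ℚ.≤-Reasoning
  N = suc (List.length (List.map f zs′))
  w = + 1 ℚ./ N
  s = seq (List.foldr _+_ 0ℝ (List.map f zs))
  instance
    w-pos : ℚ.Positive w
    w-pos = ℚ.normalize-pos 1 N
    L-pos : ℚ.Positive L
    L-pos = ℚ.positive 0<L

-- Permutation matrices from permutations

countᵇ-false : ∀ n → Vec.countᵇ id (tabulate {n = n} λ _ → false) ≡ 0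
countᵇ-false zero    = refl
countᵇ-false (suc n) = countᵇ-false n

countᵇ-unit : ∀ {n} (i : Fin n) → Vec.countᵇ id (tabulate λ j → does (i Fin.≟ j)) ≡ 1
countᵇ-unit {suc n} zero    = cong suc (countᵇ-false n)
countᵇ-unit {suc n} (suc i) = countᵇ-unit i

permutationMatrix : ∀ {n} → Permutation′ n → Matrix01 n
permutationMatrix π = tabulate λ i → tabulate λ j → does (π ⟨$⟩ʳ i Fin.≟ j)

lookup-permutationMatrix : ∀ {n} (π : Permutation′ n) i j →
  Vec.lookup (row (permutationMatrix π) i) j ≡ does (π ⟨$⟩ʳ i Fin.≟ j)
lookup-permutationMatrix π i j = trans
  (cong (λ r → Vec.lookup r j) (lookup∘tabulate _ i)) (lookup∘tabulate _ j)

permutationMatrix-isPermutationMatrix : ∀ {n} (π : Permutation′ n) →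
  IsPermutationMatrix (permutationMatrix π)
permutationMatrix-isPermutationMatrix π =
    (λ i → trans (cong (Vec.countᵇ id) (lookup∘tabulate _ i)) (countᵇ-unit (π ⟨$⟩ʳ i)))
  , (λ j → trans (cong (Vec.countᵇ id) (column≡ j)) (countᵇ-unit (π ⟨$⟩ˡ j)))
  where
  -- Because `π` sends `i` to `j` exactly when its inverse sends `j` to `i`, column `j` is again a
  -- unit vector, and the count for rows applies to it.
  column≡ : ∀ j → column (permutationMatrix π) j ≡ tabulate λ i → does (π ⟨$⟩ˡ j Fin.≟ i)
  column≡ j = trans (sym (tabulate-∘ (λ r → Vec.lookup r j) _))
    (tabulate-cong λ i → trans (lookup∘tabulate _ j)
      (does-⇔ (mk⇔ (λ { refl → Perm.inverseˡ π }) (λ { refl → Perm.inverseʳ π }))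
        (π ⟨$⟩ʳ i Fin.≟ j) (π ⟨$⟩ˡ j Fin.≟ i)))

transpose-left : ∀ {n} (i j : Fin n) → Perm.transpose i j ⟨$⟩ʳ i ≡ j
transpose-left i j rewrite dec-true (i Fin.≟ i) refl = refl

-- Objectives with a single nonzero coefficient

module _ {m n} (I : Instance m n) where

  open Instance I

  -- The four nested sums collapse from the outside in: at each level, an index other than the
  -- chosen one already makes every inner term vanish.
  objective-single : ∀ a b c d →
    (∀ i j k l → ¬ (i ≡ a × j ≡ b × k ≡ c × l ≡ d) → Q i j k l ≡ 0ℝ) →
    (∀ i j → C i j ≡ 0ℝ) → (∀ k l → D k l ≡ 0ℝ) → ∀ x y t →
    seq (objective I (x , y)) t ≡ seq (Q a b c d * entry x a b * entry y c d) t
  objective-single a b c d Q≡0 C≡0 D≡0 x y t = begin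
    seq (objective I (x , y)) t
      ≡⟨ cong₂ ℚ._+_ (cong₂ ℚ._+_ quadratic (linear C x C≡0)) (linear D y D≡0) ⟩
    seq (term a b c d) t ℚ.+ 0ℚ ℚ.+ 0ℚ
      ≡⟨ trans (ℚ.+-identityʳ _) (ℚ.+-identityʳ _) ⟩
    seq (term a b c d) t ∎
    where
    open ≡-Reasoning
    seq-0*≡0 : ∀ {r} z → r ≡ 0ℝ → seq (r * z) t ≡ 0ℚ
    seq-0*≡0 z refl = ℚ.*-zeroˡ (seq z t)
    linear : ∀ {p} (A : Fin p → Fin p → ℝ) z → (∀ i j → A i j ≡ 0ℝ) →
             seq (∑ λ i → ∑ λ j → A i j * entry z i j) t ≡ 0ℚ
    linear A z A≡0 = ∑-zero (λ i → ∑ λ j → A i j * entry z i j) t λ i →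
      ∑-zero (λ j → A i j * entry z i j) t λ j → seq-0*≡0 (entry z i j) (A≡0 i j)
    term : Fin m → Fin m → Fin n → Fin n → ℝ
    term i j k l = Q i j k l * entry x i j * entry y k l
    term≡0 : ∀ i j k l → ¬ (i ≡ a × j ≡ b × k ≡ c × l ≡ d) → seq (term i j k l) t ≡ 0ℚ
    term≡0 i j k l ≢ = trans
      (cong (ℚ._* seq (entry y k l) t) (seq-0*≡0 (entry x i j) (Q≡0 i j k l ≢)))
      (ℚ.*-zeroˡ (seq (entry y k l) t))
    ∑₁ : Fin m → Fin m → Fin n → ℝ
    ∑₁ i j k = ∑ (term i j k)
    ∑₂ : Fin m → Fin m → ℝ
    ∑₂ i j = ∑ (∑₁ i j)
    ∑₃ : Fin m → ℝ
    ∑₃ i = ∑ (∑₂ i)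
    quadratic : seq (∑ ∑₃) t ≡ seq (term a b c d) t
    quadratic = begin
      seq (∑ ∑₃) t           ≡⟨ ∑-single ∑₃ t a (λ i i≢a →
                                  ∑-zero (∑₂ i) t λ j → ∑-zero (∑₁ i j) t λ k →
                                  ∑-zero (term i j k) t λ l →
                                  term≡0 i j k l λ (i≡a , _) → i≢a i≡a) ⟩
      seq (∑ (∑₂ a)) t       ≡⟨ ∑-single (∑₂ a) t b (λ j j≢b →
                                  ∑-zero (∑₁ a j) t λ k → ∑-zero (term a j k) t λ l →
                                  term≡0 a j k l λ (_ , j≡b , _) → j≢b j≡b) ⟩
      seq (∑ (∑₁ a b)) t     ≡⟨ ∑-single (∑₁ a b) t c (λ k k≢c →
                                  ∑-zero (term a b k) t λ l →
                                  term≡0 a b k l λ (_ , _ , k≡c , _) → k≢c k≡c) ⟩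
      seq (∑ (term a b c)) t ≡⟨ ∑-single (term a b c) t d (λ l l≢d →
                                  term≡0 a b c l λ (_ , _ , _ , l≡d) → l≢d l≡d) ⟩
      seq (term a b c d) t   ∎

-- The instance, its local optimum and its minimum

module Construction {n} (a b : Fin n) (a≢b : a ≢ b) (L : ℚ) (0<L : 0ℚ ℚ.< L) where

  entryᵇ : Matrix01 n → Bool
  entryᵇ x = Vec.lookup (row x a) b

  identity transposition : Matrix01 n
  identity      = permutationMatrix Perm.id
  transposition = permutationMatrix (Perm.transpose a b)

  entryᵇ-identity : entryᵇ identity ≡ false
  entryᵇ-identity =
    trans (lookup-permutationMatrix Perm.id a b) (dec-false (a Fin.≟ b) a≢b)

  entryᵇ-transposition : entryᵇ transposition ≡ true
  entryᵇ-transposition = trans (lookup-permutationMatrix (Perm.transpose a b) a b)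
    (dec-true (Perm.transpose a b ⟨$⟩ʳ a Fin.≟ b) (transpose-left a b))

  abab? : ∀ i j k l → Dec (i ≡ a × j ≡ b × k ≡ a × l ≡ b)
  abab? i j k l = (i Fin.≟ a) ×-dec (j Fin.≟ b) ×-dec (k Fin.≟ a) ×-dec (l Fin.≟ b)

  cost : Fin n → Fin n → Fin n → Fin n → ℝ
  cost i j k l = if does (abab? i j k l) then fromℚ (ℚ.- L) else 0ℝ

  I : Instance n n
  I = record { Q = cost ; C = λ _ _ → 0ℝ ; D = λ _ _ → 0ℝ }

  f : Solution n n → ℝ
  f = objective I

  value : Bool → ℚ
  value c = if c then ℚ.- L else 0ℚ

  value≤0 : ∀ c → value c ℚ.≤ 0ℚ
  value≤0 true  = ℚ.<⇒≤ (ℚ.neg-antimono-< 0<L)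
  value≤0 false = ℚ.≤-refl

  -L≤value : ∀ c → ℚ.- L ℚ.≤ value c
  -L≤value true  = ℚ.≤-refl
  -L≤value false = ℚ.<⇒≤ (ℚ.neg-antimono-< 0<L)

  -- Feasibility is not assumed, and the right side is free of `t`: every objective value is
  -- represented by a constant sequence, either 0 or `- L`. The order facts below thus reduce to a
  -- case split on one Boolean.
  f-value : ∀ x y t → seq (f (x , y)) t ≡ value (entryᵇ x ∧ entryᵇ y)
  f-value x y t = trans
    (objective-single I a b a b
      (λ i j k l ≢ → cong (if_then fromℚ (ℚ.- L) else 0ℝ) (dec-false (abab? i j k l) ≢))
      (λ _ _ → refl) (λ _ _ → refl) x y t)
    (trans
      (cong (λ c → seq ((if c then fromℚ (ℚ.- L) else 0ℝ) * entry x a b * entry y a b) t)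
        (dec-true (abab? a b a b) (refl , refl , refl , refl)))
      term-value)
    where
    term-value : seq (fromℚ (ℚ.- L) * entry x a b * entry y a b) t
               ≡ value (entryᵇ x ∧ entryᵇ y)
    term-value with entryᵇ x | entryᵇ y
    ... | true  | true  = trans (ℚ.*-identityʳ _) (ℚ.*-identityʳ _)
    ... | true  | false = ℚ.*-zeroʳ (ℚ.- L ℚ.* 1ℚ)
    ... | false | true  = trans (ℚ.*-identityʳ _) (ℚ.*-zeroʳ (ℚ.- L))
    ... | false | false = ℚ.*-zeroʳ (ℚ.- L ℚ.* 0ℚ)

  f-identityˡ : ∀ y t → seq (f (identity , y)) t ≡ 0ℚ
  f-identityˡ y t = trans (f-value identity y t)
    (cong (λ c → value (c ∧ entryᵇ y)) entryᵇ-identity)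

  f-identityʳ : ∀ x t → seq (f (x , identity)) t ≡ 0ℚ
  f-identityʳ x t = trans (f-value x identity t)
    (cong value (trans (cong (entryᵇ x ∧_) entryᵇ-identity) (∧-zeroʳ (entryᵇ x))))

  f-transposition : ∀ t → seq (f (transposition , transposition)) t ≡ ℚ.- L
  f-transposition t = trans (f-value transposition transposition t)
    (cong (λ c → value (c ∧ c)) entryᵇ-transposition)

  identity-feasible : Feasible (identity , identity)
  identity-feasible = p , p
    where p = permutationMatrix-isPermutationMatrix Perm.id

  transposition-feasible : Feasible (transposition , transposition)
  transposition-feasible = p , p
    where p = permutationMatrix-isPermutationMatrix (Perm.transpose a b)

  identity-locallyOptimal : ∀ h → LocallyOptimal h I (identity , identity)
  identity-locallyOptimal h (x , _) (inj₁ (_ , _ , refl)) =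
    ≤-pointwise (f (identity , identity)) (f (x , identity)) λ t → ℚ.≤-reflexive
      (trans (f-identityˡ identity t) (sym (f-identityʳ x t)))
  identity-locallyOptimal h (_ , y) (inj₂ (_ , _ , refl)) =
    ≤-pointwise (f (identity , identity)) (f (identity , y)) λ t → ℚ.≤-reflexive
      (trans (f-identityˡ identity t) (sym (f-identityˡ y t)))

  isMinimum : IsMinimum Feasible f (fromℚ (ℚ.- L))
  isMinimum =
      ( (transposition , transposition) , transposition-feasible
      , ≃-pointwise (f (transposition , transposition)) (fromℚ (ℚ.- L)) f-transposition )
    , λ (x , y) _ → ≤-pointwise (fromℚ (ℚ.- L)) (f (x , y)) λ t →
        ℚ.≤-trans (-L≤value (entryᵇ x ∧ entryᵇ y)) (ℚ.≤-reflexive (sym (f-value x y t)))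

  identity>average : f (identity , identity) > averageObjective I
  identity>average = mean-<0 f (feasibleSolutions n n) (f (identity , identity))
    (λ (x , y) t → ℚ.≤-trans (ℚ.≤-reflexive (f-value x y t))
      (value≤0 (entryᵇ x ∧ entryᵇ y)))
    (feasibleSolutions-complete (transposition , transposition) transposition-feasible)
    0<L f-transposition (f-identityˡ identity)

  -- The local optimum has value 0, so the maximum of 1 and its absolute value is 1, and the claim
  -- becomes `K < L` with margin 1.
  gap : ∀ K → Eventually (λ t → seq K t ℚ.+ 1ℚ ℚ.≤ L) →
        f (identity , identity) - fromℚ (ℚ.- L) > K * (1ℝ ⊔ ∣ f (identity , identity) ∣)
  gap K (N , K+1≤L) = 1ℚ , ℚ.positive⁻¹ 1ℚ , N , λ t N≤t → subst
    -- Here `v` abstracts the objective value at index `t`. Once it is replaced by `0ℚ`, the maximum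
    -- computes to `1ℚ`.
    (λ v → seq K t ℚ.* (1ℚ ℚ.⊔ (v ℚ.⊔ ℚ.- v)) ℚ.+ 1ℚ ℚ.≤ v ℚ.- (ℚ.- L))
    (sym (f-identityˡ identity t))
    (begin
      seq K t ℚ.* 1ℚ ℚ.+ 1ℚ   ≡⟨ cong (ℚ._+ 1ℚ) (ℚ.*-identityʳ (seq K t)) ⟩
      seq K t ℚ.+ 1ℚ          ≤⟨ K+1≤L t N≤t ⟩
      L                       ≡⟨ ⁻¹-involutive L ⟨
      ℚ.- (ℚ.- L)             ≡⟨ ℚ.+-identityˡ (ℚ.- (ℚ.- L)) ⟨
      0ℚ ℚ.- (ℚ.- L)          ∎)
    where open ℚ.≤-Reasoning

theorem6 : ∀ (h : ℕ) → 2 ℕ.≤ h → ∀ (K : ℝ) → K > 0ℝ →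
    ∃[ m ] ∃[ n ] h ℕ.≤ m × m ℕ.≤ n ×
    (Σ[ I ∈ Instance m n ] Σ[ z ∈ Solution m n ]
    Feasible z ×
    LocallyOptimal h I z ×
    (∃[ μ ] IsMinimum Feasible (objective I) μ ×
    objective I z - μ > K * (1ℝ ⊔ ∣ objective I z ∣)) ×
    objective I z > averageObjective I)
theorem6 h@(suc (suc _)) (s≤s (s≤s z≤n)) K _ =
  let
    B , 0<B , N , K≤B = eventually-≤ K
    -- `B` eventually bounds `K` from above; the extra 1 is the margin that `gap` requires.
    L = B ℚ.+ 1ℚ
    -- Matching on `2 ≤ h` exposes two distinct indices, so both sizes can be `h` itself.
    open Construction {h} zero (suc zero) (λ ()) L (ℚ.+-mono-< 0<B (ℚ.positive⁻¹ 1ℚ))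
  in
  h , h , ℕ.≤-refl , ℕ.≤-refl , I , (identity , identity) ,
  identity-feasible , identity-locallyOptimal h ,
  (fromℚ (ℚ.- L) , isMinimum , gap K (N , λ t N≤t → ℚ.+-monoˡ-≤ 1ℚ (K≤B t N≤t))) ,
  identity>average
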